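{- The axiomatic system $\mathbf{K}^\circ$ is sound and strongly complete with respect to the class of reflexive frames ($\mathcal{T}$-frames). That is, with $F$ the class of reflexive frames: every theorem of $\mathbf{K}^\circ$ is valid on $F$ (soundness), and for every set $\Gamma\cup\{\phi\}$ of $\mathcal{L}(\circ)$-formulas, if $\Gamma\vDash_F\phi$ then $\Gamma\vdash_{\mathbf{K}^\circ}\phi$ (strong completeness).
   Context: Let $\mathbf{P}$ be a set of propositional variables, with $p,q\in\mathbf{P}$ distinct. The language $\mathcal{L}(\circ)$ is given by $\phi::=r\mid\neg\phi\mid(\phi\land\phi)\mid\circ\phi$ with $r\in\mathbf{P}$; other Boolean connectives and $\top$ are the usual abbreviations. A frame is $\langle S,R\rangle$ with $S$ a nonempty set and $R\subseteq S\times S$; it is reflexive if $R$ is. A model based on a frame is $\mathcal{M}=\langle S,R,V\rangle$ with $V:\mathbf{P}\to\mathcal{P}(S)$. Satisfaction: $\mathcal{M},s\vDash r$ iff $s\in V(r)$; Booleans as usual; $\mathcal{M},s\vDash\circ\phi$ iff ($\mathcal{M},s\vDash\phi$ implies that $\mathcal{M},t\vDash\phi$ for all $t$ with $sRt$). For a class $F$ of frames, $\phi$ is valid on $F$ if $\mathcal{M},s\vDash\phi$ for every model $\mathcal{M}$ based on a frame in $F$ and every $s$ in $\mathcal{M}$; $\Gamma\vDash_F\phi$ means: for every model $\mathcal{M}$ based on a frame in $F$ and every $s$ in $\mathcal{M}$, if $\mathcal{M},s\vDash\gamma$ for all $\gamma\in\Gamma$ then $\mathcal{M},s\vDash\phi$.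 The system $\mathbf{K}^\circ$ has as axioms all propositional tautologies, $\circ\top$, $\neg p\to\circ p$, and $\circ p\land\circ q\to\circ(p\land q)$, and as inference rules uniform substitution, modus ponens, and the rule: from $\phi\to\psi$ infer $\circ\phi\land\phi\to\circ\psi$. A derivation from $\Gamma$ to $\phi$ in the system, written $\Gamma\vdash\phi$ (with the system as subscript), is a finite sequence of $\mathcal{L}(\circ)$-formulas (ending in $\phi$) in which each formula is either an instantiation of an axiom, or an element of $\Gamma$, or the result of applying an inference rule to prior formulas in the sequence. A theorem is a formula $\phi$ for which there is a derivation from $\emptyset$ to $\phi$. -}

module Defs where

open import Level using (Level; suc; _⊔_)
open import Data.Bool.Base as Bool using (Bool; true; not)
open import Data.List.Base using (List; []; _∷_)
open import Data.List.Membership.Propositional using () renaming (_∈_ to _∈ˡ_)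
open import Data.Product.Base using (_×_; ∃-syntax)
open import Relation.Binary.Core using (Rel)
open import Relation.Binary.Definitions using (Reflexive)
open import Relation.Binary.PropositionalEquality.Core using (_≡_)
open import Relation.Nullary.Negation.Core using (¬_)
open import Relation.Unary using (Pred; _∈_; ∅)

private
  variable
    ℓ ℓ′ : Level
    P : Set ℓ

infix  9 ¬ᶠ_ ○_
infixr 7 _∧ᶠ_
infixr 5 _⇒ᶠ_

data Formula (P : Set ℓ) : Set ℓ where
  var  : P → Formula P
  ¬ᶠ_  : Formula P → Formula P
  _∧ᶠ_ : Formula P → Formula P → Formula P
  ○_   : Formula P → Formula P

_⇒ᶠ_ : Formula P → Formula P → Formula P
φ ⇒ᶠ ψ = ¬ᶠ (φ ∧ᶠ ¬ᶠ ψ)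

infixl 10 _[_]

_[_] : Formula P → (P → Formula P) → Formula P
var r    [ σ ] = σ r
(¬ᶠ φ)   [ σ ] = ¬ᶠ (φ [ σ ])
(φ ∧ᶠ ψ) [ σ ] = (φ [ σ ]) ∧ᶠ (ψ [ σ ])
(○ φ)    [ σ ] = ○ (φ [ σ ])

record Frame ℓ : Set (suc ℓ) where
  field
    S        : Set ℓ
    R        : Rel S ℓ
    nonempty : S

record Model (P : Set ℓ) : Set (suc ℓ) where
  field
    frame : Frame ℓ
  open Frame frame public
  field
    V : P → Pred S ℓ

infix 4 _,_⊨_

_,_⊨_ : (M : Model P) → Model.S M → Formula P → Set _
M , s ⊨ var r    = s ∈ Model.V M r
M , s ⊨ ¬ᶠ φ     = ¬ (M , s ⊨ φ)
M , s ⊨ φ ∧ᶠ ψ   = (M , s ⊨ φ) × (M , s ⊨ ψ)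
M , s ⊨ ○ φ      = M , s ⊨ φ → ∀ t → Model.R M s t → M , t ⊨ φ

ReflexiveFrames : ∀ {ℓ} → Pred (Frame ℓ) ℓ
ReflexiveFrames 𝔉 = Reflexive (Frame.R 𝔉)

module _ {P : Set ℓ} where

  ValidOn : Pred (Frame ℓ) ℓ′ → Formula P → Set _
  ValidOn F φ = (M : Model P) → Model.frame M ∈ F → ∀ s → M , s ⊨ φ

  infix 4 _⊨[_]_

  _⊨[_]_ : Pred (Formula P) ℓ → Pred (Frame ℓ) ℓ′ → Formula P → Set _
  Γ ⊨[ F ] φ = (M : Model P) → Model.frame M ∈ F → ∀ s →
               (∀ {γ} → γ ∈ Γ → M , s ⊨ γ) → M , s ⊨ φ

-- Formulas of the form ○ φ count as atoms: the truth value of ○ φ is given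
-- by w φ, independently of the structure of φ.

eval : (v : P → Bool) (w : Formula P → Bool) → Formula P → Bool
eval v w (var r)  = v r
eval v w (¬ᶠ φ)   = not (eval v w φ)
eval v w (φ ∧ᶠ ψ) = eval v w φ Bool.∧ eval v w ψ
eval v w (○ φ)    = w φ

Tautology : Formula P → Set _
Tautology φ = ∀ v w → eval v w φ ≡ true

module K° {P : Set ℓ} (p q : P) where

  -- The primitive language has no constants, so ⊤ abbreviates a tautology
  -- in the designated variable p.

  ⊤ᶠ : Formula P
  ⊤ᶠ = ¬ᶠ (var p ∧ᶠ ¬ᶠ var p)

  data Axiom : Formula P → Set ℓ where
    taut : ∀ {φ} → Tautology φ → Axiom φ
    ○⊤   : Axiom (○ ⊤ᶠ)
    ¬⇒○  : Axiom (¬ᶠ var p ⇒ᶠ ○ var p)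
    ○∧   : Axiom (○ var p ∧ᶠ ○ var q ⇒ᶠ ○ (var p ∧ᶠ var q))

  -- Rules apply to any earlier formulas, including those that depend on Γ.

  data Justified (Γ : Pred (Formula P) ℓ′) (prior : List (Formula P)) :
                 Formula P → Set (ℓ ⊔ ℓ′) where
    axiom : ∀ {φ} → Axiom φ → (σ : P → Formula P) →
            Justified Γ prior (φ [ σ ])
    prem  : ∀ {φ} → φ ∈ Γ → Justified Γ prior φ
    sub   : ∀ {φ} → φ ∈ˡ prior → (σ : P → Formula P) →
            Justified Γ prior (φ [ σ ])
    mp    : ∀ {φ ψ} → φ ∈ˡ prior → φ ⇒ᶠ ψ ∈ˡ prior →
            Justified Γ prior ψ
    ○-mon : ∀ {φ ψ} → φ ⇒ᶠ ψ ∈ˡ prior →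
            Justified Γ prior (○ φ ∧ᶠ φ ⇒ᶠ ○ ψ)

  -- Sequences are listed with the most recent formula first.

  data Derivation (Γ : Pred (Formula P) ℓ′) : List (Formula P) → Set (ℓ ⊔ ℓ′) where
    []  : Derivation Γ []
    _∷_ : ∀ {φ prior} → Justified Γ prior φ → Derivation Γ prior →
          Derivation Γ (φ ∷ prior)

  infix 4 _⊢_

  _⊢_ : Pred (Formula P) ℓ′ → Formula P → Set _
  Γ ⊢ φ = ∃[ prior ] Derivation Γ (φ ∷ prior)

  Theorem : Formula P → Set ℓ
  Theorem φ = ∅ ⊢ φ

{-# OPTIONS --safe #-}
module Submission where

-- The rules act on premises too, so the consequences of Γ are closed under
-- substitution, and collapsing the variables that do not occur in φ reduces
-- completeness to a countable language.  There the canonical model has as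
-- worlds the Boolean-valued complete theories extending the logic, with s R t
-- iff every ψ such that ψ and ○ ψ hold at s holds at t, which is
-- reflexive outright.  The set of these ψ is itself closed under modus ponens,
-- so when φ holds and ○ φ fails at s, Lindenbaum's lemma applied to it yields a
-- successor refuting φ.

open import Axiom.ExcludedMiddle using (ExcludedMiddle)
open import Data.Bool.Base as Bool using (Bool; true; false; not)
open import Data.List.Base using (List; []; _∷_; _++_)
open import Data.List.Membership.Propositional using () renaming (_∈_ to _∈ˡ_)
open import Data.List.Membership.Propositional.Properties using (∈-++⁺ˡ; ∈-++⁺ʳ)
open import Data.List.Relation.Binary.Subset.Propositional using (_⊆_)
open import Data.List.Relation.Unary.All as All using (All; []; _∷_)
open import Data.List.Relation.Unary.Any using (here; there)
open import Data.Nat.Base using (ℕ; zero; suc; _+_; _⊔_; _≤_; _≤′_; s≤s; ≤′-refl; ≤′-step)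
open import Data.Nat.Properties using (≤⇒≤′; m≤m⊔n; m≤n⊔m; ≤-trans; ≤-refl; +-suc; +-identityʳ)
open import Data.Product.Base using (_×_; _,_; proj₁; proj₂; ∃-syntax)
open import Data.Sum.Base using (_⊎_; inj₁; inj₂)
open import Function.Base using (_∘_; id)
open import Function.Bundles using (_⇔_; mk⇔; Equivalence)
open import Level using (Level; Lift; lift)
open import Relation.Binary.PropositionalEquality
  using (_≡_; _≢_; refl; sym; trans; cong; cong₂; subst)
open import Relation.Nullary.Decidable.Core
  using (yes; no; does; proof; ¬?; _×-dec_; decidable-stable)
open import Relation.Nullary.Decidable using (does-⇔; dec-true; dec-false)
open import Relation.Nullary.Negation.Core using (¬_; contradiction)
open import Relation.Nullary.Reflects as Reflects
  using (Reflects; ofʸ; ofⁿ; invert; ¬-reflects; _×-reflects_)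
open import Relation.Unary using (Pred; _∈_; _∉_; ∅)
open import Defs

private
  variable
    a b ℓ : Level
    A : Set a
    B : Set b

open Equivalence using (to; from)

-- Substitution and renaming

rename : (A → B) → Formula A → Formula B
rename f (var r)  = var (f r)
rename f (¬ᶠ φ)   = ¬ᶠ rename f φ
rename f (φ ∧ᶠ ψ) = rename f φ ∧ᶠ rename f ψ
rename f (○ φ)    = ○ rename f φ

-- The right side is a substitution so that the rule `sub` can produce the round trip of a premise.
rename-rename : ∀ (f : B → A) (g : A → B) φ → rename f (rename g φ) ≡ φ [ var ∘ f ∘ g ]
rename-rename f g (var r)  = refl
rename-rename f g (¬ᶠ φ)   = cong ¬ᶠ_ (rename-rename f g φ)
rename-rename f g (φ ∧ᶠ ψ) = cong₂ _∧ᶠ_ (rename-rename f g φ) (rename-rename f g ψ)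
rename-rename f g (○ φ)    = cong ○_ (rename-rename f g φ)

vars : Formula A → List A
vars (var r)  = r ∷ []
vars (¬ᶠ φ)   = vars φ
vars (φ ∧ᶠ ψ) = vars φ ++ vars ψ
vars (○ φ)    = vars φ

[]-identity : ∀ {σ : A → Formula A} φ →
              (∀ {r} → r ∈ˡ vars φ → σ r ≡ var r) → φ [ σ ] ≡ φ
[]-identity (var r)  eq = eq (here refl)
[]-identity (¬ᶠ φ)   eq = cong ¬ᶠ_ ([]-identity φ eq)
[]-identity (φ ∧ᶠ ψ) eq = cong₂ _∧ᶠ_ ([]-identity φ (eq ∘ ∈-++⁺ˡ))
                                     ([]-identity ψ (eq ∘ ∈-++⁺ʳ (vars φ)))
[]-identity (○ φ)    eq = cong ○_ ([]-identity φ eq)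

-- A `○` formula is an atom, so its value can be pulled back along `f` through `w`, even where `f`
-- identifies atoms.
eval-rename : ∀ (f : A → B) v w φ →
              eval v w (rename f φ) ≡ eval (v ∘ f) (w ∘ rename f) φ
eval-rename f v w (var r)  = refl
eval-rename f v w (¬ᶠ φ)   = cong not (eval-rename f v w φ)
eval-rename f v w (φ ∧ᶠ ψ) = cong₂ Bool._∧_ (eval-rename f v w φ) (eval-rename f v w ψ)
eval-rename f v w (○ φ)    = refl

Tautology-rename : ∀ (f : A → B) {φ} → Tautology φ → Tautology (rename f φ)
Tautology-rename f {φ} t v w = trans (eval-rename f v w φ) (t _ _)

var-[] : (φ : Formula A) → φ [ var ] ≡ φ
var-[] φ = []-identity φ (λ _ → refl)

-- Tautologies

module _ (x y : Formula A) where

  taut-K : Tautology (x ⇒ᶠ y ⇒ᶠ x)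
  taut-K v w with eval v w x | eval v w y
  ... | false | _     = refl
  ... | true  | false = refl
  ... | true  | true  = refl

  taut-∧₁ : Tautology (x ∧ᶠ y ⇒ᶠ x)
  taut-∧₁ v w with eval v w x | eval v w y
  ... | false | _     = refl
  ... | true  | false = refl
  ... | true  | true  = refl

  taut-∧₂ : Tautology (x ∧ᶠ y ⇒ᶠ y)
  taut-∧₂ v w with eval v w x | eval v w y
  ... | false | _     = refl
  ... | true  | false = refl
  ... | true  | true  = refl

  taut-pair : Tautology (x ⇒ᶠ y ⇒ᶠ x ∧ᶠ y)
  taut-pair v w with eval v w x | eval v w y
  ... | false | _     = refl
  ... | true  | false = refl
  ... | true  | true  = refl

  taut-explosion : Tautology (x ⇒ᶠ ¬ᶠ x ⇒ᶠ y)
  taut-explosion v w with eval v w x | eval v w y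
  ... | false | _     = refl
  ... | true  | false = refl
  ... | true  | true  = refl

  taut-cases : Tautology ((x ⇒ᶠ y) ⇒ᶠ (¬ᶠ x ⇒ᶠ y) ⇒ᶠ y)
  taut-cases v w with eval v w x | eval v w y
  ... | false | false = refl
  ... | false | true  = refl
  ... | true  | false = refl
  ... | true  | true  = refl

  taut-mp : Tautology (x ∧ᶠ (x ⇒ᶠ y) ⇒ᶠ y)
  taut-mp v w with eval v w x | eval v w y
  ... | false | _     = refl
  ... | true  | false = refl
  ... | true  | true  = refl

taut-I : (x : Formula A) → Tautology (x ⇒ᶠ x)
taut-I x v w with eval v w x
... | false = refl
... | true  = refl

taut-S : (x y z : Formula A) →
         Tautology ((x ⇒ᶠ y ⇒ᶠ z) ⇒ᶠ (x ⇒ᶠ y) ⇒ᶠ x ⇒ᶠ z)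
taut-S x y z v w with eval v w x | eval v w y | eval v w z
... | false | _     | _     = refl
... | true  | false | _     = refl
... | true  | true  | false = refl
... | true  | true  | true  = refl

-- Enumeration of the formulas over ℕ

-- Cantor's walk along the antidiagonals of constant sum.
next : ℕ × ℕ → ℕ × ℕ
next (i , zero)  = zero , suc i
next (i , suc j) = suc i , j

unpair : ℕ → ℕ × ℕ
unpair zero    = zero , zero
unpair (suc n) = next (unpair n)

unpair-surjective : ∀ i j → ∃[ n ] unpair n ≡ (i , j)
unpair-surjective i j = diagonal (i + j) i j refl
  where
  -- The walk is traced backwards: a predecessor has a smaller sum, or the same sum and a smaller
  -- first coordinate.
  diagonal : ∀ s i j → i + j ≡ s → ∃[ n ] unpair n ≡ (i , j)
  diagonal s zero zero _ = zero , refl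
  diagonal (suc s) zero (suc j) refl =
    let n , eq = diagonal s j zero (+-identityʳ j) in suc n , cong next eq
  diagonal s (suc i) j eq′ =
    let n , eq = diagonal s i (suc j) (trans (+-suc i j) eq′) in suc n , cong next eq

depth : Formula A → ℕ
depth (var _)  = zero
depth (¬ᶠ φ)   = suc (depth φ)
depth (φ ∧ᶠ ψ) = suc (depth φ ⊔ depth ψ)
depth (○ φ)    = suc (depth φ)

-- The first argument is fuel, since the components of `unpair n` are not structurally smaller than
-- `n`. Every tag from 3 on means conjunction; codes may repeat, as only surjectivity matters.
decode : ℕ → ℕ → Formula ℕ
decode zero    n = var n
decode (suc d) n with unpair n
... | 0 , m = var m
... | 1 , m = ¬ᶠ decode d m
... | 2 , m = ○ decode d m
... | _ , m = decode d (proj₁ (unpair m)) ∧ᶠ decode d (proj₂ (unpair m))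

decode-surjective : ∀ φ {d} → depth φ ≤ d → ∃[ n ] decode d n ≡ φ
decode-surjective (var k) {zero} _ = k , refl
decode-surjective (var k) {suc d} _ with n , eq ← unpair-surjective 0 k = n , lemma
  where
  lemma : decode (suc d) n ≡ var k
  lemma rewrite eq = refl
decode-surjective (¬ᶠ φ) {suc d} (s≤s φ≤d)
  with m , eq ← decode-surjective φ φ≤d
  with n , eq′ ← unpair-surjective 1 m = n , lemma
  where
  lemma : decode (suc d) n ≡ ¬ᶠ φ
  lemma rewrite eq′ | eq = refl
decode-surjective (○ φ) {suc d} (s≤s φ≤d)
  with m , eq ← decode-surjective φ φ≤d
  with n , eq′ ← unpair-surjective 2 m = n , lemma
  where
  lemma : decode (suc d) n ≡ ○ φ
  lemma rewrite eq′ | eq = refl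
decode-surjective (φ ∧ᶠ ψ) {suc d} (s≤s φψ≤d)
  with i , eqᵢ ← decode-surjective φ (≤-trans (m≤m⊔n (depth φ) (depth ψ)) φψ≤d)
  with j , eqⱼ ← decode-surjective ψ (≤-trans (m≤n⊔m (depth φ) (depth ψ)) φψ≤d)
  with m , eq ← unpair-surjective i j
  with n , eq′ ← unpair-surjective 3 m = n , lemma
  where
  lemma : decode (suc d) n ≡ φ ∧ᶠ ψ
  lemma rewrite eq′ | eq | eqᵢ | eqⱼ = refl

enum : ℕ → Formula ℕ
enum n = decode (proj₁ (unpair n)) (proj₂ (unpair n))

enum-surjective : ∀ φ → ∃[ n ] enum n ≡ φ
enum-surjective φ
  with m , eq ← decode-surjective φ ≤-refl
  with n , eq′ ← unpair-surjective (depth φ) m = n , lemma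
  where
  lemma : enum n ≡ φ
  lemma rewrite eq′ = eq

-- Theories and Lindenbaum's lemma

record IsTheory {A : Set a} (Θ : Pred (Formula A) ℓ) : Set (a Level.⊔ ℓ) where
  field
    ∈-taut : ∀ {x} → Tautology x → x ∈ Θ
    ∈-mp   : ∀ {x y} → (x ⇒ᶠ y) ∈ Θ → x ∈ Θ → y ∈ Θ

open IsTheory

-- The theory generated by `Θ` and `x`, encoded so that the deduction theorem holds by definition.
_⊕_ : Pred (Formula A) ℓ → Formula A → Pred (Formula A) ℓ
(Θ ⊕ x) y = (x ⇒ᶠ y) ∈ Θ

⊕-isTheory : {Θ : Pred (Formula A) ℓ} → IsTheory Θ → ∀ x → IsTheory (Θ ⊕ x)
⊕-isTheory th x .∈-taut {y} t = ∈-mp th (∈-taut th (taut-K y x)) (∈-taut th {y} t)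
⊕-isTheory th x .∈-mp {y} {z} f y∈ = ∈-mp th (∈-mp th (∈-taut th (taut-S x y z)) f) y∈

record IsValuation {A : Set a} (m : Formula A → Bool) : Set a where
  field
    ¬-hom : ∀ x → m (¬ᶠ x) ≡ not (m x)
    ∧-hom : ∀ x y → m (x ∧ᶠ y) ≡ m x Bool.∧ m y

  ⇒-elim : ∀ {x y} → m (x ⇒ᶠ y) ≡ true → m x ≡ true → m y ≡ true
  ⇒-elim {x} {y} f mx
    rewrite ¬-hom (x ∧ᶠ ¬ᶠ y) | ∧-hom x (¬ᶠ y) | ¬-hom y | mx with m y
  ... | true = refl

  ∧-intro : ∀ {x y} → m x ≡ true → m y ≡ true → m (x ∧ᶠ y) ≡ true
  ∧-intro {x} {y} mx my rewrite ∧-hom x y | mx | my = refl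

module Lindenbaum (em : ExcludedMiddle ℓ) (φ : Formula ℕ) where

  -- The invariant is avoidance of `φ` rather than consistency. Since `φ ∈ Θ ⊕ x` unfolds to
  -- `(x ⇒ᶠ φ) ∈ Θ`, a rejected `x` leaves the trace `x ⇒ᶠ φ`.
  extend : Pred (Formula ℕ) ℓ → Formula ℕ → Pred (Formula ℕ) ℓ
  extend Θ x with em {φ ∈ Θ ⊕ x}
  ... | yes _ = Θ
  ... | no  _ = Θ ⊕ x

  module _ {Θ : Pred (Formula ℕ) ℓ} (th : IsTheory Θ) where

    extend-isTheory : ∀ x → IsTheory (extend Θ x)
    extend-isTheory x with em {φ ∈ Θ ⊕ x}
    ... | yes _ = th
    ... | no  _ = ⊕-isTheory th x

    extend-⊇ : ∀ x {y} → y ∈ Θ → y ∈ extend Θ x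
    extend-⊇ x {y} y∈ with em {φ ∈ Θ ⊕ x}
    ... | yes _ = y∈
    ... | no  _ = ∈-mp th (∈-taut th (taut-K y x)) y∈

    extend-avoids : ∀ x → φ ∉ Θ → φ ∉ extend Θ x
    extend-avoids x φ∉ with em {φ ∈ Θ ⊕ x}
    ... | yes _   = φ∉
    ... | no  φ∉⊕ = φ∉⊕

    extend-decides : ∀ x → x ∈ extend Θ x ⊎ (x ⇒ᶠ φ) ∈ extend Θ x
    extend-decides x with em {φ ∈ Θ ⊕ x}
    ... | yes φ∈⊕ = inj₂ φ∈⊕
    ... | no  _   = inj₁ (∈-taut th (taut-I x))

  module _ {Θ : Pred (Formula ℕ) ℓ} (th : IsTheory Θ) (φ∉Θ : φ ∉ Θ) where

    chain : ℕ → Pred (Formula ℕ) ℓ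
    chain zero    = Θ
    chain (suc n) = extend (chain n) (enum n)

    chain-isTheory : ∀ n → IsTheory (chain n)
    chain-isTheory zero    = th
    chain-isTheory (suc n) = extend-isTheory (chain-isTheory n) (enum n)

    chain-avoids : ∀ n → φ ∉ chain n
    chain-avoids zero    = φ∉Θ
    chain-avoids (suc n) = extend-avoids (chain-isTheory n) (enum n) (chain-avoids n)

    chain-mono : ∀ {m n} → m ≤′ n → ∀ {x} → x ∈ chain m → x ∈ chain n
    chain-mono ≤′-refl x∈ = x∈
    chain-mono (≤′-step {n} m≤n) x∈ =
      extend-⊇ (chain-isTheory n) (enum n) (chain-mono m≤n x∈)

    limit : Pred (Formula ℕ) ℓ
    limit x = ∃[ n ] x ∈ chain n

    limit-isTheory : IsTheory limit
    limit-isTheory .∈-taut t = zero , ∈-taut th t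
    limit-isTheory .∈-mp (m , f) (n , x) =
      m ⊔ n , ∈-mp (chain-isTheory (m ⊔ n))
                 (chain-mono (≤⇒≤′ (m≤m⊔n m n)) f)
                 (chain-mono (≤⇒≤′ (m≤n⊔m m n)) x)

    limit-avoids : φ ∉ limit
    limit-avoids (n , φ∈) = chain-avoids n φ∈

    limit-decides : ∀ x → x ∈ limit ⊎ (x ⇒ᶠ φ) ∈ limit
    limit-decides x with n , refl ← enum-surjective x
      with extend-decides (chain-isTheory n) (enum n)
    ... | inj₁ x∈  = inj₁ (suc n , x∈)
    ... | inj₂ x⇒∈ = inj₂ (suc n , x⇒∈)

    -- Having both `x` and `¬ᶠ x` would give `φ` by explosion; rejecting both would make each imply
    -- `φ`, giving `φ` by cases.
    limit-¬ : ∀ x → ¬ᶠ x ∈ limit ⇔ x ∉ limit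
    limit-¬ x = mk⇔
      (λ ¬x∈ x∈ → limit-avoids (∈-mp lim (∈-mp lim (∈-taut lim (taut-explosion x φ)) x∈) ¬x∈))
      complete
      where
      lim = limit-isTheory
      complete : x ∉ limit → ¬ᶠ x ∈ limit
      complete x∉ with limit-decides x | limit-decides (¬ᶠ x)
      ... | inj₁ x∈ | _        = contradiction x∈ x∉
      ... | inj₂ _  | inj₁ ¬x∈ = ¬x∈
      ... | inj₂ f  | inj₂ g   =
        contradiction (∈-mp lim (∈-mp lim (∈-taut lim (taut-cases x φ)) f) g) limit-avoids

    limit-∧ : ∀ x y → x ∧ᶠ y ∈ limit ⇔ (x ∈ limit × y ∈ limit)
    limit-∧ x y = mk⇔
      (λ xy → ∈-mp lim (∈-taut lim (taut-∧₁ x y)) xy , ∈-mp lim (∈-taut lim (taut-∧₂ x y)) xy)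
      (λ (x∈ , y∈) → ∈-mp lim (∈-mp lim (∈-taut lim (taut-pair x y)) x∈) y∈)
      where lim = limit-isTheory

    lindenbaum : ∃[ m ] IsValuation m × (∀ {x} → x ∈ Θ → m x ≡ true) × m φ ≡ false
    lindenbaum =
        (λ x → does (em {x ∈ limit}))
      , record
        -- `does` of `¬? em` and of `em ×-dec em` computes to `not` and `Bool.∧`, so the
        -- equivalences become homomorphism equations.
        { ¬-hom = λ x → does-⇔ (limit-¬ x) em (¬? em)
        ; ∧-hom = λ x y → does-⇔ (limit-∧ x y) em (em ×-dec em)
        }
      , (λ x∈ → dec-true em (zero , x∈))
      , dec-false em limit-avoids

-- The canonical model

-- The axioms are schemes, which stands in for uniform substitution. The instance used below
-- consists of the formulas whose renamings are derivable from `Γ`.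
record IsLogic {A : Set a} (Λ : Pred (Formula A) ℓ) : Set (a Level.⊔ ℓ) where
  field
    isTheory : IsTheory Λ
    ○-⊤      : ∀ x → ○ (x ⇒ᶠ x) ∈ Λ
    ¬⇒○      : ∀ x → (¬ᶠ x ⇒ᶠ ○ x) ∈ Λ
    ○-∧      : ∀ x y → (○ x ∧ᶠ ○ y ⇒ᶠ ○ (x ∧ᶠ y)) ∈ Λ
    ○-mon    : ∀ {x y} → (x ⇒ᶠ y) ∈ Λ → (○ x ∧ᶠ x ⇒ᶠ ○ y) ∈ Λ

module Canonical (em : ExcludedMiddle ℓ) {Λ : Pred (Formula ℕ) ℓ} (logic : IsLogic Λ) where

  open IsLogic logic

  -- Membership is Boolean-valued because worlds that are predicates into Set ℓ
  -- would form a type in Set (suc ℓ), too large for a Frame ℓ.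
  record World : Set ℓ where
    field
      mem         : Formula ℕ → Bool
      isValuation : IsValuation mem
      valid       : ∀ {x} → x ∈ Λ → mem x ≡ true
    open IsValuation isValuation public

  open World

  _∋_ : World → Formula ℕ → Set
  s ∋ x = mem s x ≡ true

  -- On reflexive frames `x` together with `○ x` expresses the necessity of `x`.
  □ : World → Pred (Formula ℕ) ℓ
  □ s x = Lift ℓ (s ∋ x × s ∋ (○ x))

  _R_ : World → World → Set ℓ
  s R t = ∀ {x} → x ∈ □ s → t ∋ x

  -- Necessitation: `x` yields `⊤ ⇒ᶠ x`, hence `○ ⊤ ∧ᶠ ⊤ ⇒ᶠ ○ x` by monotonicity, and the antecedent
  -- is in `Λ`.
  □-Λ : ∀ s {x} → x ∈ Λ → x ∈ □ s
  □-Λ s {x} x∈ = lift (valid s x∈ ,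
    ⇒-elim s (valid s (○-mon (∈-mp isTheory (∈-taut isTheory (taut-K x ⊤)) x∈)))
             (∧-intro s (valid s (○-⊤ x)) (valid s (∈-taut isTheory (taut-I x)))))
    where ⊤ = x ⇒ᶠ x

  -- This is the axiom K for the defined necessity: `○-∧` joins `x` and `x ⇒ᶠ y` under one `○`, and
  -- monotonicity along `taut-mp` passes to `y`.
  □-isTheory : ∀ s → IsTheory (□ s)
  □-isTheory s .∈-taut t = □-Λ s (∈-taut isTheory t)
  □-isTheory s .∈-mp {x} {y} (lift (f , ○f)) (lift (mx , ○x)) = lift (⇒-elim s f mx ,
    ⇒-elim s (valid s (○-mon (∈-taut isTheory (taut-mp x y))))
             (∧-intro s (⇒-elim s (valid s (○-∧ x (x ⇒ᶠ y))) (∧-intro s ○x ○f))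
                        (∧-intro s mx f)))

  refute : ∀ {Θ} → IsTheory Θ → (∀ {x} → x ∈ Λ → x ∈ Θ) → ∀ {φ} → φ ∉ Θ →
           ∃[ t ] (∀ {x} → x ∈ Θ → t ∋ x) × mem t φ ≡ false
  refute th Λ⊆Θ {φ} φ∉ with m , isVal , Θ⊆m , mφ ← Lindenbaum.lindenbaum em φ th φ∉ =
    record { mem = m ; isValuation = isVal ; valid = Θ⊆m ∘ Λ⊆Θ } , Θ⊆m , mφ

  successor : ∀ s {x} → mem s (○ x) ≡ false → ∃[ t ] s R t × mem t x ≡ false
  successor s ○x≡f = refute (□-isTheory s) (□-Λ s)
    λ { (lift (_ , ○x)) → contradiction (trans (sym ○x) ○x≡f) λ () }

  -- The contrapositive of `¬⇒○`. In the truth lemma it supplies the antecedent in the meaning of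
  -- `○`.
  ○-false⇒true : ∀ s {x} → mem s (○ x) ≡ false → s ∋ x
  ○-false⇒true s {x} ○x≡f with mem s x in eq
  ... | true  = refl
  ... | false = contradiction (trans (sym ○x≡f) ○x) λ ()
    where
    ○x : s ∋ (○ x)
    ○x = ⇒-elim s (valid s (¬⇒○ x)) (trans (¬-hom s x) (cong not eq))

  -- Worlds speak about `ℕ`, and variables of `P` are read through their numbers, so equally
  -- numbered variables are indistinguishable.
  canonicalModel : {P : Set ℓ} → (P → ℕ) → World → Model P
  canonicalModel g s₀ = record
    { frame = record { S = World ; R = _R_ ; nonempty = s₀ }
    ; V     = λ r s → Lift ℓ (s ∋ var (g r))
    }

  canonical-reflexive : ∀ {s} → s R s
  canonical-reflexive (lift (mx , _)) = mx

  module _ {P : Set ℓ} (g : P → ℕ) (s₀ : World) where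

    private M = canonicalModel g s₀

    -- `Reflects` carries both directions through the induction. For `○ ψ`, truth of `ψ` at `s` must
    -- be turned into membership in `□ s`, and non-membership at a successor into falsity there.
    truth : ∀ ψ s → Reflects (M , s ⊨ ψ) (mem s (rename g ψ))
    truth (var r) s with mem s (var (g r))
    ... | true  = ofʸ (lift refl)
    ... | false = ofⁿ λ { (lift ()) }
    truth (¬ᶠ ψ) s rewrite ¬-hom s (rename g ψ) = ¬-reflects (truth ψ s)
    truth (ψ ∧ᶠ χ) s rewrite ∧-hom s (rename g ψ) (rename g χ) =
      truth ψ s ×-reflects truth χ s
    truth (○ ψ) s with mem s (○ rename g ψ) in eq
    ... | true  = ofʸ λ sψ t sRt →
      invert (subst (Reflects _)
        (sRt (lift (Reflects.det (truth ψ s) (ofʸ sψ) , eq))) (truth ψ t))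
    ... | false with t , sRt , tψ ← successor s eq = ofⁿ λ ○ψ →
      invert (subst (Reflects _) tψ (truth ψ t))
        (○ψ (invert (subst (Reflects _) (○-false⇒true s eq) (truth ψ s))) t sRt)

  -- Every world contains `Λ`, so the premises hold throughout the model and only `φ` needs a world
  -- that omits it.
  canonical-completeness : {P : Set ℓ} (g : P → ℕ) {φ : Formula P} → rename g φ ∉ Λ →
    ¬ ((λ γ → rename g γ ∈ Λ) ⊨[ ReflexiveFrames ] φ)
  canonical-completeness g {φ} φ∉ Λ⊨φ
    with s , _ , sφ ← refute isTheory id φ∉ =
    invert (subst (Reflects _) sφ (truth g s φ s))
      (Λ⊨φ (canonicalModel g s) (λ {t} → canonical-reflexive {t}) s
        λ {γ} γ∈ → invert (subst (Reflects _) (valid s γ∈) (truth g s γ s)))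

-- Soundness

_ᴹ[_] : {P : Set ℓ} → Model P → (P → Formula P) → Model P
M ᴹ[ σ ] = record { frame = Model.frame M ; V = λ r s → M , s ⊨ σ r }

-- Substitution only changes the valuation; the frame stays, so validity on a class of frames is
-- preserved.
⊨-[] : {P : Set ℓ} (M : Model P) (σ : P → Formula P) → ∀ φ s →
       (M ᴹ[ σ ] , s ⊨ φ) ⇔ (M , s ⊨ φ [ σ ])
⊨-[] M σ (var r)  s = mk⇔ id id
⊨-[] M σ (¬ᶠ φ)   s = mk⇔ (_∘ from (⊨-[] M σ φ s)) (_∘ to (⊨-[] M σ φ s))
⊨-[] M σ (φ ∧ᶠ ψ) s =
  mk⇔ (λ (x , y) → to (⊨-[] M σ φ s) x , to (⊨-[] M σ ψ s) y)
      (λ (x , y) → from (⊨-[] M σ φ s) x , from (⊨-[] M σ ψ s) y)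
⊨-[] M σ (○ φ)    s =
  mk⇔ (λ h x t sRt → to (⊨-[] M σ φ t) (h (from (⊨-[] M σ φ s) x) t sRt))
      (λ h x t sRt → from (⊨-[] M σ φ t) (h (to (⊨-[] M σ φ s) x) t sRt))

module _ {P : Set ℓ} (em : ExcludedMiddle ℓ) where

  ⊨-⇒ : (M : Model P) → ∀ {s} φ ψ → M , s ⊨ φ ⇒ᶠ ψ → M , s ⊨ φ → M , s ⊨ ψ
  ⊨-⇒ M φ ψ f x = decidable-stable em λ ¬ψ → f (x , ¬ψ)

  -- Feeding `eval` the actual truth values at `s` of variables and `○` formulas makes it compute
  -- truth at `s`.
  eval-⊨ : (M : Model P) → ∀ s φ →
    Reflects (M , s ⊨ φ)
      (eval (λ r → does (em {M , s ⊨ var r})) (λ χ → does (em {M , s ⊨ ○ χ})) φ)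
  eval-⊨ M s (var r)  = proof em
  eval-⊨ M s (¬ᶠ φ)   = ¬-reflects (eval-⊨ M s φ)
  eval-⊨ M s (φ ∧ᶠ ψ) = eval-⊨ M s φ ×-reflects eval-⊨ M s ψ
  eval-⊨ M s (○ φ)    = proof em

  Tautology-⊨ : ∀ {φ} → Tautology φ → (M : Model P) → ∀ s → M , s ⊨ φ
  Tautology-⊨ {φ} t M s = invert (subst (Reflects _) (t _ _) (eval-⊨ M s φ))

module _ {P : Set ℓ} (em : ExcludedMiddle ℓ) {p q : P} where

  open K° p q

  private
    Valid : Pred (Formula P) _
    Valid = ValidOn ReflexiveFrames

  Valid-[] : ∀ {φ} σ → φ ∈ Valid → φ [ σ ] ∈ Valid
  Valid-[] {φ} σ φ-valid M R-refl s =
    to (⊨-[] M σ φ s) (φ-valid (M ᴹ[ σ ]) R-refl s)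

  Axiom-sound : ∀ {φ} → Axiom φ → φ ∈ Valid
  Axiom-sound (taut {φ} t) M _ s = Tautology-⊨ em {φ = φ} t M s
  Axiom-sound ○⊤  M _ s = λ _ t _ (x , ¬x) → ¬x x
  Axiom-sound ¬⇒○ M _ s (¬x , ¬○x) = ¬○x λ x → contradiction x ¬x
  Axiom-sound ○∧  M _ s ((○x , ○y) , ¬○xy) =
    ¬○xy λ (x , y) t sRt → ○x x t sRt , ○y y t sRt

  Justified-sound : ∀ {φ prior} → Justified ∅ prior φ → All Valid prior → φ ∈ Valid
  Justified-sound (axiom {φ} ax σ) ih = Valid-[] {φ} σ (Axiom-sound ax)
  Justified-sound (sub {φ} φ∈ σ) ih = Valid-[] {φ} σ (All.lookup ih φ∈)
  Justified-sound (mp {φ} {ψ} φ∈ f∈) ih M R-refl s =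
    ⊨-⇒ em M φ ψ (All.lookup ih f∈ M R-refl s) (All.lookup ih φ∈ M R-refl s)
  Justified-sound (○-mon {φ} {ψ} f∈) ih M R-refl s ((○φ , sφ) , ¬○ψ) =
    -- The implication is valid, hence available at the successor `t` too.
    ¬○ψ λ _ t sRt → ⊨-⇒ em M φ ψ (All.lookup ih f∈ M R-refl t) (○φ sφ t sRt)

  Derivation-sound : ∀ {φs} → Derivation ∅ φs → All Valid φs
  Derivation-sound []      = []
  Derivation-sound (j ∷ d) = Justified-sound j ih ∷ ih
    where ih = Derivation-sound d

-- Derivability

module _ {P : Set ℓ} {p q : P} {Γ : Pred (Formula P) ℓ} where

  open K° p q

  Justified-weaken : ∀ {φ xs ys} → xs ⊆ ys → Justified Γ xs φ → Justified Γ ys φ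
  Justified-weaken xs⊆ys (axiom ax σ) = axiom ax σ
  Justified-weaken xs⊆ys (prem φ∈)    = prem φ∈
  Justified-weaken xs⊆ys (sub φ∈ σ)   = sub (xs⊆ys φ∈) σ
  Justified-weaken xs⊆ys (mp φ∈ f∈)   = mp (xs⊆ys φ∈) (xs⊆ys f∈)
  Justified-weaken xs⊆ys (○-mon f∈)   = ○-mon (xs⊆ys f∈)

  Derivation-++ : ∀ {xs ys} → Derivation Γ xs → Derivation Γ ys → Derivation Γ (xs ++ ys)
  Derivation-++ []      e = e
  Derivation-++ (j ∷ d) e = Justified-weaken ∈-++⁺ˡ j ∷ Derivation-++ d e

  ⊢-prem : ∀ {φ} → φ ∈ Γ → Γ ⊢ φ
  ⊢-prem φ∈ = _ , prem φ∈ ∷ []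

  ⊢-axiom : ∀ {φ} → Axiom φ → (σ : P → Formula P) → Γ ⊢ φ [ σ ]
  ⊢-axiom ax σ = _ , axiom ax σ ∷ []

  ⊢-taut : ∀ {φ} → Tautology φ → Γ ⊢ φ
  ⊢-taut {φ} t = subst (Γ ⊢_) (var-[] φ) (⊢-axiom (taut {φ = φ} t) var)

  ⊢-sub : ∀ {φ} → Γ ⊢ φ → (σ : P → Formula P) → Γ ⊢ φ [ σ ]
  ⊢-sub (_ , d) σ = _ , sub (here refl) σ ∷ d

  ⊢-mp : ∀ {φ ψ} → Γ ⊢ φ ⇒ᶠ ψ → Γ ⊢ φ → Γ ⊢ ψ
  ⊢-mp (xs , d) (ys , e) =
    _ , mp (∈-++⁺ʳ (_ ∷ xs) (here refl)) (here refl) ∷ Derivation-++ d e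

  ⊢-○-mon : ∀ {φ ψ} → Γ ⊢ φ ⇒ᶠ ψ → Γ ⊢ ○ φ ∧ᶠ φ ⇒ᶠ ○ ψ
  ⊢-○-mon (_ , d) = _ , ○-mon (here refl) ∷ d

  -- This is the one modal axiom in two variables; as `p` and `q` differ, a single substitution can
  -- send them to arbitrary formulas.
  ⊢-○∧ : ExcludedMiddle ℓ → p ≢ q → ∀ φ ψ → Γ ⊢ ○ φ ∧ᶠ ○ ψ ⇒ᶠ ○ (φ ∧ᶠ ψ)
  ⊢-○∧ em p≢q φ ψ =
    subst (Γ ⊢_) (cong₂ (λ x y → ○ x ∧ᶠ ○ y ⇒ᶠ ○ (x ∧ᶠ y)) σp σq) (⊢-axiom ○∧ σ)
    where
    σ : P → Formula P
    σ r = Bool.if does (em {r ≡ p}) then φ else ψ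
    σp : σ p ≡ φ
    σp = cong (Bool.if_then φ else ψ) (dec-true em refl)
    σq : σ q ≡ ψ
    σq = cong (Bool.if_then φ else ψ) (dec-false em (p≢q ∘ sym))

  ⊢-rename-isLogic : ExcludedMiddle ℓ → p ≢ q → (f : A → P) →
                     IsLogic (λ (x : Formula A) → Γ ⊢ rename f x)
  ⊢-rename-isLogic em p≢q f = record
    { isTheory = record
      { ∈-taut = λ {x} t → ⊢-taut (Tautology-rename f {x} t)
      ; ∈-mp   = ⊢-mp
      }
    -- A constant substitution turns `⊤ᶠ`, which is `var p ⇒ᶠ var p`, into an implication from the
    -- renamed `x` to itself.
    ; ○-⊤   = λ x → ⊢-axiom ○⊤ (λ _ → rename f x)
    ; ¬⇒○   = λ x → ⊢-axiom ¬⇒○ (λ _ → rename f x)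
    ; ○-∧   = λ x y → ⊢-○∧ em p≢q (rename f x) (rename f y)
    ; ○-mon = ⊢-○-mon
    }

-- Numbering the variables of a formula

lookupOr : A → List A → ℕ → A
lookupOr z []       _       = z
lookupOr z (x ∷ xs) zero    = x
lookupOr z (x ∷ xs) (suc n) = lookupOr z xs n

module _ {P : Set ℓ} (em : ExcludedMiddle ℓ) where

  -- Everything outside the list is numbered by its length, which `lookupOr` reads back as the
  -- default; this is the collapse of the variables absent from `φ`.
  indexOf : List P → P → ℕ
  indexOf []       r = zero
  indexOf (x ∷ xs) r with em {r ≡ x}
  ... | yes _ = zero
  ... | no  _ = suc (indexOf xs r)

  lookupOr-indexOf : ∀ p {xs r} → r ∈ˡ xs → lookupOr p xs (indexOf xs r) ≡ r
  lookupOr-indexOf p {x ∷ xs} {r} r∈ with em {r ≡ x}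
  lookupOr-indexOf p r∈         | yes r≡x = sym r≡x
  lookupOr-indexOf p (here r≡x) | no  r≢x = contradiction r≡x r≢x
  lookupOr-indexOf p (there r∈) | no  _   = lookupOr-indexOf p r∈

theorem36 : ∀ {ℓ} → ExcludedMiddle ℓ →
    {P : Set ℓ} (p q : P) → p ≢ q →
    let open K° p q in
    (∀ φ → Theorem φ → ValidOn ReflexiveFrames φ)
    × (∀ (Γ : Pred (Formula P) ℓ) (φ : Formula P) →
    Γ ⊨[ ReflexiveFrames ] φ → Γ ⊢ φ)
theorem36 {ℓ} em {P} p q p≢q =
  (λ _ (_ , d) → All.head (Derivation-sound em d)) , complete
  where
  open K° p q
  complete : ∀ (Γ : Pred (Formula P) ℓ) φ → Γ ⊨[ ReflexiveFrames ] φ → Γ ⊢ φ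
  complete Γ φ Γ⊨φ = decidable-stable em λ Γ⊬φ →
    Canonical.canonical-completeness em (⊢-rename-isLogic em p≢q f) g
      (Γ⊬φ ∘ subst (Γ ⊢_) φ-stable)
      -- Each premise `γ` qualifies for `Λ⊨`, because its round trip `γ [ var ∘ f ∘ g ]` is
      -- derivable by substitution from `γ` itself.
      λ M R-refl s Λ⊨ → Γ⊨φ M R-refl s λ {γ} γ∈ → Λ⊨
        (subst (Γ ⊢_) (sym (rename-rename f g γ)) (⊢-sub (⊢-prem γ∈) _))
    where
    g : P → ℕ
    g = indexOf em (vars φ)
    f : ℕ → P
    f = lookupOr p (vars φ)
    φ-stable : rename f (rename g φ) ≡ φ
    φ-stable = trans (rename-rename f g φ)
      ([]-identity φ (cong var ∘ lookupOr-indexOf em p))
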